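{- Quantitative parity games are in general not positionally determined, not even up to approximation: there exist a quantitative parity game $\mathcal{G}$ and a position $v$ of $\mathcal{G}$ such that for every $\varepsilon\in(0,1)$ no positional strategy of Player 0 is $\varepsilon$-optimal from $v$.
   Context: Notation: $\mathbb{R}^+$ is the set of non-negative reals, $\mathbb{R}^+_\infty=\mathbb{R}^+\cup\{\infty\}$. **Quantitative parity game.** $\mathcal{G}=(V,V_0,V_1,E,\delta,\lambda,\Omega)$: $V$ is the disjoint union of $V_0,V_1$; $E\subseteq V\times V$; $\delta$ assigns a positive real to every move in $E$; $\lambda:\{v:vE=\emptyset\}\to\mathbb{R}^+_\infty$, where $vE=\{w:(v,w)\in E\}$; $\Omega:V\to\{0,\dots,n\}$. At a non-terminal position in $V_i$, Player $i$ chooses a successor; plays end at terminal positions. The outcome of a finite play is $p(v_0\dots v_k)=\delta(v_0,v_1)\cdots\delta(v_{k-1},v_k)\cdot\lambda(v_k)$; the outcome of an infinite play is $\infty$ if the lowest priority seen infinitely often is even and $0$ if it is odd. A strategy of Player $i$ maps each history ending in a non-terminal position of $V_i$ to a successor of that position; it is positional if its choice depends only on the last position of the history. $\pi_{\sigma,\rho}(v)$ is the unique play from $v$ consistent with $\sigma$ (Player 0, maximising) and $\rho$ (Player 1, minimising). The value is $\mathrm{val}\,\mathcal{G}(v)=\sup_\sigma\inf_\rho p(\pi_{\sigma,\rho}(v))=\inf_\rho\sup_\sigma p(\pi_{\sigma,\rho}(v))$ (ranging over all, not necessarily positional, strategies; the game is called determined if the two quantities coincide for all $v$). **$\varepsilon$-optimality.**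 $k\in\mathbb{R}^+_\infty$ is $\varepsilon$-close to $p\in\mathbb{R}^+_\infty$ if either $p$ is finite and $|k-p|\le\varepsilon$, or $p=\infty$ and $k\ge1/\varepsilon$; $k$ is $\varepsilon$-above $p$ if $k\ge p'$ for some $p'$ that is $\varepsilon$-close to $p$. A strategy $\sigma$ of Player 0 is $\varepsilon$-optimal from $v$ if for every strategy $\rho$ of Player 1, $p(\pi_{\sigma,\rho}(v))$ is $\varepsilon$-above $\mathrm{val}\,\mathcal{G}(v)$. -}

module Defs where

open import Data.Empty using (⊥)
open import Data.Fin using (Fin; toℕ)
open import Data.Nat as ℕ using (ℕ; zero; suc)
import Data.Nat.Properties as ℕ
open import Data.Nat.Divisibility using (_∣_)
open import Data.Product using (Σ; Σ-syntax; ∃; ∃-syntax; _×_; _,_; proj₁; proj₂)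
open import Data.Rational as ℚ using (ℚ; 0ℚ; 1ℚ)
import Data.Rational.Properties as ℚ
open import Data.Rational.Solver using (module +-*-Solver)
open import Data.Sum using (_⊎_; inj₁; inj₂)
open import Data.Unit using (⊤; tt)
open import Relation.Binary.PropositionalEquality
open import Relation.Nullary using (¬_)

------------------------------------------------------------------------
-- Real numbers

-- The library has no reals.  A real is a Cauchy sequence of rationals;
-- reals are compared by _≈_ below, not by _≡_.

Eventually : (ℕ → Set) → Set
Eventually P = ∃[ N ] ∀ n → N ℕ.≤ n → P n

Cauchy : (ℕ → ℚ) → Set
Cauchy x = ∀ ε → 0ℚ ℚ.< ε →
  ∃[ N ] ∀ m n → N ℕ.≤ m → N ℕ.≤ n → ℚ.∣ x m ℚ.- x n ∣ ℚ.< ε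

record ℝ : Set where
  constructor mkℝ
  field
    seq    : ℕ → ℚ
    cauchy : Cauchy seq
open ℝ public

infix 4 _≤_ _<_ _≈_

_≤_ : ℝ → ℝ → Set
x ≤ y = ∀ ε → 0ℚ ℚ.< ε → Eventually λ n → seq x n ℚ.< seq y n ℚ.+ ε

_<_ : ℝ → ℝ → Set
x < y = Σ[ q ∈ ℚ ] 0ℚ ℚ.< q × Eventually λ n → seq x n ℚ.+ q ℚ.< seq y n

_≈_ : ℝ → ℝ → Set
x ≈ y = x ≤ y × y ≤ x

private

  divPos : (a b : ℚ) → 0ℚ ℚ.< b → ℚ
  divPos a b 0<b = a ℚ.* (ℚ.1/ b) {{ℚ.>-nonZero 0<b}}

  divPos-pos : ∀ {a b} → 0ℚ ℚ.< a → (0<b : 0ℚ ℚ.< b) → 0ℚ ℚ.< divPos a b 0<b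
  divPos-pos {a} {b} 0<a 0<b =
    subst (ℚ._< divPos a b 0<b) (ℚ.*-zeroˡ i)
      (ℚ.*-monoˡ-<-pos i {{ℚ.1/pos⇒pos b {{ℚ.positive 0<b}}}} 0<a)
    where i = (ℚ.1/ b) {{ℚ.>-nonZero 0<b}}

  divPos-* : ∀ a b (0<b : 0ℚ ℚ.< b) → b ℚ.* divPos a b 0<b ≡ a
  divPos-* a b 0<b = begin
    b ℚ.* (a ℚ.* i)  ≡⟨ solve 3 (λ b a i → b :* (a :* i) := a :* (b :* i)) refl b a i ⟩
    a ℚ.* (b ℚ.* i)  ≡⟨ cong (a ℚ.*_) (ℚ.*-inverseʳ b {{ℚ.>-nonZero 0<b}}) ⟩
    a ℚ.* 1ℚ         ≡⟨ ℚ.*-identityʳ a ⟩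
    a                ∎
    where
    open ≡-Reasoning
    open +-*-Solver
    i = (ℚ.1/ b) {{ℚ.>-nonZero 0<b}}

  *-pos : ∀ {a b} → 0ℚ ℚ.< a → 0ℚ ℚ.< b → 0ℚ ℚ.< a ℚ.* b
  *-pos {a} {b} 0<a 0<b = subst (ℚ._< a ℚ.* b) (ℚ.*-zeroˡ b)
    (ℚ.*-monoˡ-<-pos b {{ℚ.positive 0<b}} 0<a)

  +-pos : ∀ {a b} → 0ℚ ℚ.< a → 0ℚ ℚ.< b → 0ℚ ℚ.< a ℚ.+ b
  +-pos {a} {b} 0<a 0<b = subst (ℚ._< a ℚ.+ b) (ℚ.+-identityˡ 0ℚ) (ℚ.+-mono-< 0<a 0<b)

  *-mono-<-nonNeg : ∀ {a b c d} → 0ℚ ℚ.≤ a → 0ℚ ℚ.≤ c → a ℚ.< b → c ℚ.< d →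
                    a ℚ.* c ℚ.< b ℚ.* d
  *-mono-<-nonNeg {a} {b} {c} {d} 0≤a 0≤c a<b c<d = ℚ.≤-<-trans
    (ℚ.*-monoʳ-≤-nonNeg c {{ℚ.nonNegative 0≤c}} (ℚ.<⇒≤ a<b))
    (ℚ.*-monoʳ-<-pos b {{ℚ.positive (ℚ.≤-<-trans 0≤a a<b)}} c<d)

  0<1 : 0ℚ ℚ.< 1ℚ
  0<1 = ℚ.positive⁻¹ 1ℚ

  half : ℚ → ℚ
  half a = divPos a (1ℚ ℚ.+ 1ℚ) (+-pos 0<1 0<1)

  half-pos : ∀ {a} → 0ℚ ℚ.< a → 0ℚ ℚ.< half a
  half-pos 0<a = divPos-pos 0<a (+-pos 0<1 0<1)

  half+half : ∀ a → half a ℚ.+ half a ≡ a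
  half+half a = trans
    (solve 1 (λ h → h :+ h := (con 1ℚ :+ con 1ℚ) :* h) refl (half a))
    (divPos-* a (1ℚ ℚ.+ 1ℚ) (+-pos 0<1 0<1))
    where open +-*-Solver

  ∣-∣-sym : ∀ a b → ℚ.∣ a ℚ.- b ∣ ≡ ℚ.∣ b ℚ.- a ∣
  ∣-∣-sym a b = trans
    (cong ℚ.∣_∣ (solve 2 (λ a b → a :- b := :- (b :- a)) refl a b))
    (ℚ.∣-p∣≡∣p∣ (b ℚ.- a))
    where open +-*-Solver

  ∣a∣≤∣a-b∣+∣b∣ : ∀ a b → ℚ.∣ a ∣ ℚ.≤ ℚ.∣ a ℚ.- b ∣ ℚ.+ ℚ.∣ b ∣
  ∣a∣≤∣a-b∣+∣b∣ a b = subst (λ t → ℚ.∣ t ∣ ℚ.≤ ℚ.∣ a ℚ.- b ∣ ℚ.+ ℚ.∣ b ∣)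
    (solve 2 (λ a b → (a :- b) :+ b := a) refl a b)
    (ℚ.∣p+q∣≤∣p∣+∣q∣ (a ℚ.- b) b)
    where open +-*-Solver

  a≤b+c⇒a-c≤b : ∀ {a b c} → a ℚ.≤ b ℚ.+ c → a ℚ.- c ℚ.≤ b
  a≤b+c⇒a-c≤b {a} {b} {c} p = subst (a ℚ.- c ℚ.≤_)
    (solve 2 (λ b c → (b :+ c) :- c := b) refl b c)
    (ℚ.+-monoˡ-≤ (ℚ.- c) p)
    where open +-*-Solver

  ∣∣a∣-∣b∣∣≤∣a-b∣ : ∀ a b → ℚ.∣ ℚ.∣ a ∣ ℚ.- ℚ.∣ b ∣ ∣ ℚ.≤ ℚ.∣ a ℚ.- b ∣
  ∣∣a∣-∣b∣∣≤∣a-b∣ a b with ℚ.∣p∣≡p∨∣p∣≡-p (ℚ.∣ a ∣ ℚ.- ℚ.∣ b ∣)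
  ... | inj₁ eq = subst (ℚ._≤ ℚ.∣ a ℚ.- b ∣) (sym eq) (a≤b+c⇒a-c≤b (∣a∣≤∣a-b∣+∣b∣ a b))
  ... | inj₂ eq = subst (ℚ._≤ ℚ.∣ a ℚ.- b ∣)
    (trans (solve 2 (λ x y → y :- x := :- (x :- y)) refl ℚ.∣ a ∣ ℚ.∣ b ∣) (sym eq))
    (subst (ℚ.∣ b ∣ ℚ.- ℚ.∣ a ∣ ℚ.≤_) (∣-∣-sym b a) (a≤b+c⇒a-c≤b (∣a∣≤∣a-b∣+∣b∣ b a)))
    where open +-*-Solver

  bounded : ∀ {x} → Cauchy x →
            Σ[ B ∈ ℚ ] 0ℚ ℚ.< B × Eventually λ n → ℚ.∣ x n ∣ ℚ.< B
  bounded {x} cx with cx 1ℚ 0<1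
  ... | N , p = 1ℚ ℚ.+ ℚ.∣ x N ∣
              , ℚ.<-≤-trans 0<1
                  (subst (ℚ._≤ 1ℚ ℚ.+ ℚ.∣ x N ∣) (ℚ.+-identityʳ 1ℚ)
                    (ℚ.+-monoʳ-≤ 1ℚ (ℚ.0≤∣p∣ (x N))))
              , N
              , λ n N≤n → ℚ.≤-<-trans (∣a∣≤∣a-b∣+∣b∣ (x n) (x N))
                  (ℚ.+-monoˡ-< ℚ.∣ x N ∣ (p n N N≤n ℕ.≤-refl))

fromℚ : ℚ → ℝ
fromℚ q = mkℝ (λ _ → q) λ ε 0<ε →
  0 , λ _ _ _ _ → subst (λ t → ℚ.∣ t ∣ ℚ.< ε) (sym (ℚ.+-inverseʳ q)) 0<ε

0ℝ 1ℝ : ℝ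
0ℝ = fromℚ 0ℚ
1ℝ = fromℚ 1ℚ

infixl 6 _-_

_-_ : ℝ → ℝ → ℝ
mkℝ x cx - mkℝ y cy = mkℝ (λ n → x n ℚ.- y n) diff
  where
  diff : Cauchy (λ n → x n ℚ.- y n)
  diff ε 0<ε with cx (half ε) (half-pos 0<ε) | cy (half ε) (half-pos 0<ε)
  ... | N , p | M , q = N ℕ.⊔ M , λ m n l l′ → ℚ.≤-<-trans
    (subst (λ t → ℚ.∣ t ∣ ℚ.≤ ℚ.∣ x m ℚ.- x n ∣ ℚ.+ ℚ.∣ y m ℚ.- y n ∣)
      (solve 4 (λ a b c d → (a :- b) :- (c :- d) := (a :- c) :- (b :- d)) refl
        (x m) (x n) (y m) (y n))
      (ℚ.∣p-q∣≤∣p∣+∣q∣ (x m ℚ.- x n) (y m ℚ.- y n)))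
    (subst (ℚ.∣ x m ℚ.- x n ∣ ℚ.+ ℚ.∣ y m ℚ.- y n ∣ ℚ.<_) (half+half ε)
      (ℚ.+-mono-<
        (p m n (ℕ.m⊔n≤o⇒m≤o N M l) (ℕ.m⊔n≤o⇒m≤o N M l′))
        (q m n (ℕ.m⊔n≤o⇒n≤o N M l) (ℕ.m⊔n≤o⇒n≤o N M l′))))
    where open +-*-Solver

∣_∣ʳ : ℝ → ℝ
∣ mkℝ x cx ∣ʳ = mkℝ (λ n → ℚ.∣ x n ∣) λ ε 0<ε →
  proj₁ (cx ε 0<ε) , λ m n l l′ →
    ℚ.≤-<-trans (∣∣a∣-∣b∣∣≤∣a-b∣ (x m) (x n)) (proj₂ (cx ε 0<ε) m n l l′)

private

  ∣ab-cd∣< : ∀ {A B} a b c d η → ℚ.∣ a ∣ ℚ.< A → ℚ.∣ d ∣ ℚ.< B →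
             ℚ.∣ a ℚ.- c ∣ ℚ.< η → ℚ.∣ b ℚ.- d ∣ ℚ.< η →
             ℚ.∣ a ℚ.* b ℚ.- c ℚ.* d ∣ ℚ.< (A ℚ.+ B) ℚ.* η
  ∣ab-cd∣< {A} {B} a b c d η a<A d<B a-c<η b-d<η = begin-strict
    ℚ.∣ a ℚ.* b ℚ.- c ℚ.* d ∣
      ≡⟨ cong ℚ.∣_∣ (solve 4 (λ a b c d → a :* b :- c :* d := a :* (b :- d) :+ d :* (a :- c))
           refl a b c d) ⟩
    ℚ.∣ a ℚ.* (b ℚ.- d) ℚ.+ d ℚ.* (a ℚ.- c) ∣
      ≤⟨ ℚ.∣p+q∣≤∣p∣+∣q∣ (a ℚ.* (b ℚ.- d)) (d ℚ.* (a ℚ.- c)) ⟩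
    ℚ.∣ a ℚ.* (b ℚ.- d) ∣ ℚ.+ ℚ.∣ d ℚ.* (a ℚ.- c) ∣
      ≡⟨ cong₂ ℚ._+_ (ℚ.∣p*q∣≡∣p∣*∣q∣ a (b ℚ.- d)) (ℚ.∣p*q∣≡∣p∣*∣q∣ d (a ℚ.- c)) ⟩
    ℚ.∣ a ∣ ℚ.* ℚ.∣ b ℚ.- d ∣ ℚ.+ ℚ.∣ d ∣ ℚ.* ℚ.∣ a ℚ.- c ∣
      <⟨ ℚ.+-mono-<
           (*-mono-<-nonNeg (ℚ.0≤∣p∣ a) (ℚ.0≤∣p∣ (b ℚ.- d)) a<A b-d<η)
           (*-mono-<-nonNeg (ℚ.0≤∣p∣ d) (ℚ.0≤∣p∣ (a ℚ.- c)) d<B a-c<η) ⟩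
    A ℚ.* η ℚ.+ B ℚ.* η
      ≡⟨ sym (ℚ.*-distribʳ-+ η A B) ⟩
    (A ℚ.+ B) ℚ.* η ∎
    where
    open ℚ.≤-Reasoning
    open +-*-Solver

infixl 7 _*_

_*_ : ℝ → ℝ → ℝ
mkℝ x cx * mkℝ y cy = mkℝ (λ n → x n ℚ.* y n) prod
  where
  prod : Cauchy (λ n → x n ℚ.* y n)
  prod ε 0<ε = go (bounded cx) (bounded cy)
    where
    go : Σ[ A ∈ ℚ ] 0ℚ ℚ.< A × Eventually (λ n → ℚ.∣ x n ∣ ℚ.< A) →
         Σ[ B ∈ ℚ ] 0ℚ ℚ.< B × Eventually (λ n → ℚ.∣ y n ∣ ℚ.< B) →
         ∃[ N ] ∀ m n → N ℕ.≤ m → N ℕ.≤ n →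
           ℚ.∣ x m ℚ.* y m ℚ.- x n ℚ.* y n ∣ ℚ.< ε
    go (A , 0<A , N , bx) (B , 0<B , M , by) = N ℕ.⊔ M ℕ.⊔ (N′ ℕ.⊔ M′) , close
      where
      0<A+B = +-pos 0<A 0<B
      η     = divPos ε (A ℚ.+ B) 0<A+B
      0<η   = divPos-pos 0<ε 0<A+B
      N′    = proj₁ (cx η 0<η)
      M′    = proj₁ (cy η 0<η)
      close : ∀ m n → N ℕ.⊔ M ℕ.⊔ (N′ ℕ.⊔ M′) ℕ.≤ m → N ℕ.⊔ M ℕ.⊔ (N′ ℕ.⊔ M′) ℕ.≤ n →
              ℚ.∣ x m ℚ.* y m ℚ.- x n ℚ.* y n ∣ ℚ.< ε
      close m n l l′ = subst (ℚ.∣ x m ℚ.* y m ℚ.- x n ℚ.* y n ∣ ℚ.<_)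
        (divPos-* ε (A ℚ.+ B) 0<A+B)
        (∣ab-cd∣< (x m) (y m) (x n) (y n) η
          (bx m (ℕ.m⊔n≤o⇒m≤o N M (ℕ.m⊔n≤o⇒m≤o (N ℕ.⊔ M) (N′ ℕ.⊔ M′) l)))
          (by n (ℕ.m⊔n≤o⇒n≤o N M (ℕ.m⊔n≤o⇒m≤o (N ℕ.⊔ M) (N′ ℕ.⊔ M′) l′)))
          (proj₂ (cx η 0<η) m n
            (ℕ.m⊔n≤o⇒m≤o N′ M′ (ℕ.m⊔n≤o⇒n≤o (N ℕ.⊔ M) (N′ ℕ.⊔ M′) l))
            (ℕ.m⊔n≤o⇒m≤o N′ M′ (ℕ.m⊔n≤o⇒n≤o (N ℕ.⊔ M) (N′ ℕ.⊔ M′) l′)))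
          (proj₂ (cy η 0<η) m n
            (ℕ.m⊔n≤o⇒n≤o N′ M′ (ℕ.m⊔n≤o⇒n≤o (N ℕ.⊔ M) (N′ ℕ.⊔ M′) l))
            (ℕ.m⊔n≤o⇒n≤o N′ M′ (ℕ.m⊔n≤o⇒n≤o (N ℕ.⊔ M) (N′ ℕ.⊔ M′) l′))))

ℝ>0 : Set
ℝ>0 = Σ[ x ∈ ℝ ] 0ℝ < x

1ℝ>0 : ℝ>0
1ℝ>0 = 1ℝ , half 1ℚ , half-pos 0<1 , 0 , λ _ _ →
  subst₂ ℚ._<_ (ℚ.+-comm (half 1ℚ) 0ℚ) (half+half 1ℚ)
    (ℚ.+-monoʳ-< (half 1ℚ) (half-pos 0<1))

private

  below : ∀ {q a} → 0ℚ ℚ.+ q ℚ.< a → q ℚ.< a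
  below {q} {a} = subst (ℚ._< a) (ℚ.+-identityˡ q)

infixl 7 _*⁺_

_*⁺_ : ℝ>0 → ℝ>0 → ℝ>0
(x , q , 0<q , N , p) *⁺ (y , r , 0<r , M , s) =
  x * y , q ℚ.* r , *-pos 0<q 0<r , N ℕ.⊔ M , λ n l →
    subst (ℚ._< seq x n ℚ.* seq y n) (sym (ℚ.+-identityˡ (q ℚ.* r)))
      (*-mono-<-nonNeg (ℚ.<⇒≤ 0<q) (ℚ.<⇒≤ 0<r)
        (below (p n (ℕ.m⊔n≤o⇒m≤o N M l)))
        (below (s n (ℕ.m⊔n≤o⇒n≤o N M l))))

-- A tail of the sequence of x is bounded below by a positive rational;
-- the reciprocals are taken along this tail.
_⁻¹ : ℝ>0 → ℝ
(mkℝ x cx , q , 0<q , N , p) ⁻¹ = mkℝ inv inv-cauchy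
  where
  open +-*-Solver
  q< : ∀ n → q ℚ.< x (N ℕ.+ n)
  q< n = below (p (N ℕ.+ n) (ℕ.m≤m+n N n))
  0<x : ∀ n → 0ℚ ℚ.< x (N ℕ.+ n)
  0<x n = ℚ.<-trans 0<q (q< n)
  inv : ℕ → ℚ
  inv n = (ℚ.1/ x (N ℕ.+ n)) {{ℚ.>-nonZero (0<x n)}}
  inv-inverse : ∀ n → x (N ℕ.+ n) ℚ.* inv n ≡ 1ℚ
  inv-inverse n = ℚ.*-inverseʳ (x (N ℕ.+ n)) {{ℚ.>-nonZero (0<x n)}}
  -- ∣1/a - 1/b∣ a b = ∣b - a∣, while a b > q q.
  bound : ∀ ε m n → 0ℚ ℚ.< ε →
          ℚ.∣ x (N ℕ.+ m) ℚ.- x (N ℕ.+ n) ∣ ℚ.< ε ℚ.* (q ℚ.* q) →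
          ℚ.∣ inv m ℚ.- inv n ∣ ℚ.< ε
  bound ε m n 0<ε close =
    ℚ.*-cancelʳ-<-nonNeg ab {{ℚ.nonNegative (ℚ.<⇒≤ 0<ab)}}
      (subst (ℚ._< ε ℚ.* ab) (sym scaled) (ℚ.<-trans close
        (ℚ.*-monoʳ-<-pos ε {{ℚ.positive 0<ε}}
          (*-mono-<-nonNeg (ℚ.<⇒≤ 0<q) (ℚ.<⇒≤ 0<q) (q< m) (q< n)))))
    where
    a = x (N ℕ.+ m)
    b = x (N ℕ.+ n)
    ab = a ℚ.* b
    0<ab : 0ℚ ℚ.< ab
    0<ab = *-pos (0<x m) (0<x n)
    unscaled : (inv m ℚ.- inv n) ℚ.* ab ≡ b ℚ.- a
    unscaled = begin
      (inv m ℚ.- inv n) ℚ.* ab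
        ≡⟨ solve 4 (λ i j a b → (i :- j) :* (a :* b) := (a :* i) :* b :- (b :* j) :* a)
             refl (inv m) (inv n) a b ⟩
      (a ℚ.* inv m) ℚ.* b ℚ.- (b ℚ.* inv n) ℚ.* a
        ≡⟨ cong₂ (λ s t → s ℚ.* b ℚ.- t ℚ.* a) (inv-inverse m) (inv-inverse n) ⟩
      1ℚ ℚ.* b ℚ.- 1ℚ ℚ.* a
        ≡⟨ cong₂ ℚ._-_ (ℚ.*-identityˡ b) (ℚ.*-identityˡ a) ⟩
      b ℚ.- a ∎
      where open ≡-Reasoning
    scaled : ℚ.∣ inv m ℚ.- inv n ∣ ℚ.* ab ≡ ℚ.∣ a ℚ.- b ∣
    scaled = begin
      ℚ.∣ inv m ℚ.- inv n ∣ ℚ.* ab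
        ≡⟨ cong (ℚ.∣ inv m ℚ.- inv n ∣ ℚ.*_) (sym (ℚ.0≤p⇒∣p∣≡p (ℚ.<⇒≤ 0<ab))) ⟩
      ℚ.∣ inv m ℚ.- inv n ∣ ℚ.* ℚ.∣ ab ∣
        ≡⟨ sym (ℚ.∣p*q∣≡∣p∣*∣q∣ (inv m ℚ.- inv n) ab) ⟩
      ℚ.∣ (inv m ℚ.- inv n) ℚ.* ab ∣  ≡⟨ cong ℚ.∣_∣ unscaled ⟩
      ℚ.∣ b ℚ.- a ∣                   ≡⟨ ∣-∣-sym b a ⟩
      ℚ.∣ a ℚ.- b ∣                   ∎
      where open ≡-Reasoning
  inv-cauchy : Cauchy inv
  inv-cauchy ε 0<ε with cx (ε ℚ.* (q ℚ.* q)) (*-pos 0<ε (*-pos 0<q 0<q))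
  ... | M , c = M , λ m n l l′ → bound ε m n 0<ε
    (c (N ℕ.+ m) (N ℕ.+ n) (ℕ.≤-trans l (ℕ.m≤n+m m N)) (ℕ.≤-trans l′ (ℕ.m≤n+m n N)))

-- Non-negative reals extended by ∞.
data ℝ⁺∞ : Set where
  fin : (x : ℝ) → 0ℝ ≤ x → ℝ⁺∞
  ∞   : ℝ⁺∞

0∞ : ℝ⁺∞
0∞ = fin 0ℝ λ ε 0<ε → 0 , λ _ _ → subst (0ℚ ℚ.<_) (sym (ℚ.+-identityˡ ε)) 0<ε

infix 4 _≤∞_ _≈∞_

_≤∞_ : ℝ⁺∞ → ℝ⁺∞ → Set
fin x _ ≤∞ fin y _ = x ≤ y
∞       ≤∞ fin _ _ = ⊥
_       ≤∞ ∞       = ⊤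

_≈∞_ : ℝ⁺∞ → ℝ⁺∞ → Set
p ≈∞ q = p ≤∞ q × q ≤∞ p

private

  0<ab+cη : ∀ {a b c η} → 0ℚ ℚ.< a → a ℚ.< c → 0ℚ ℚ.< η → 0ℚ ℚ.< b ℚ.+ η →
            0ℚ ℚ.< a ℚ.* b ℚ.+ c ℚ.* η
  0<ab+cη {a} {b} {c} {η} 0<a a<c 0<η 0<b+η = begin-strict
    0ℚ                     <⟨ *-pos 0<a 0<b+η ⟩
    a ℚ.* (b ℚ.+ η)        ≡⟨ ℚ.*-distribˡ-+ a b η ⟩
    a ℚ.* b ℚ.+ a ℚ.* η    <⟨ ℚ.+-monoʳ-< (a ℚ.* b)
                                (ℚ.*-monoˡ-<-pos η {{ℚ.positive 0<η}} a<c) ⟩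
    a ℚ.* b ℚ.+ c ℚ.* η    ∎
    where open ℚ.≤-Reasoning

  ∣a∣<b⇒a<b : ∀ {a b} → ℚ.∣ a ∣ ℚ.< b → a ℚ.< b
  ∣a∣<b⇒a<b {a} {b} p = ℚ.≤-<-trans a≤∣a∣ p
    where
    a≤∣a∣ : a ℚ.≤ ℚ.∣ a ∣
    a≤∣a∣ with ℚ.≤-total 0ℚ a
    ... | inj₁ 0≤a = ℚ.≤-reflexive (sym (ℚ.0≤p⇒∣p∣≡p 0≤a))
    ... | inj₂ a≤0 = ℚ.≤-trans a≤0 (ℚ.0≤∣p∣ a)

  *-nonNeg : (x : ℝ>0) {y : ℝ} → 0ℝ ≤ y → 0ℝ ≤ proj₁ x * y
  *-nonNeg (x , q , 0<q , N , p) {y} 0≤y ε 0<ε = go (bounded (cauchy x))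
    where
    go : Σ[ B ∈ ℚ ] 0ℚ ℚ.< B × Eventually (λ n → ℚ.∣ seq x n ∣ ℚ.< B) →
         Eventually λ n → 0ℚ ℚ.< seq x n ℚ.* seq y n ℚ.+ ε
    go (B , 0<B , M , b) = N ℕ.⊔ (M ℕ.⊔ K) , pos
      where
      η   = divPos ε B 0<B
      0<η = divPos-pos 0<ε 0<B
      K   = proj₁ (0≤y η 0<η)
      pos : ∀ n → N ℕ.⊔ (M ℕ.⊔ K) ℕ.≤ n → 0ℚ ℚ.< seq x n ℚ.* seq y n ℚ.+ ε
      pos n l = subst (λ t → 0ℚ ℚ.< seq x n ℚ.* seq y n ℚ.+ t) (divPos-* ε B 0<B)
        (0<ab+cη
          (ℚ.<-trans 0<q (below (p n (ℕ.m⊔n≤o⇒m≤o N (M ℕ.⊔ K) l))))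
          (∣a∣<b⇒a<b (b n (ℕ.m⊔n≤o⇒m≤o M K (ℕ.m⊔n≤o⇒n≤o N (M ℕ.⊔ K) l))))
          0<η
          (proj₂ (0≤y η 0<η) n (ℕ.m⊔n≤o⇒n≤o M K (ℕ.m⊔n≤o⇒n≤o N (M ℕ.⊔ K) l))))

  ⁻¹-nonNeg : (x : ℝ>0) → 0ℝ ≤ x ⁻¹
  ⁻¹-nonNeg (mkℝ x cx , q , 0<q , N , p) ε 0<ε = 0 , λ n _ →
    let 0<xn = ℚ.<-trans 0<q (below (p (N ℕ.+ n) (ℕ.m≤m+n N n)))
        i = (ℚ.1/ x (N ℕ.+ n)) {{ℚ.>-nonZero 0<xn}}
        0<i : 0ℚ ℚ.< i
        0<i = ℚ.positive⁻¹ i {{ℚ.1/pos⇒pos (x (N ℕ.+ n)) {{ℚ.positive 0<xn}}}}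
    in +-pos 0<i 0<ε

infixl 7 _·_

_·_ : ℝ>0 → ℝ⁺∞ → ℝ⁺∞
x · fin y 0≤y = fin (proj₁ x * y) (*-nonNeg x {y} 0≤y)
x · ∞         = ∞

1/_ : ℝ>0 → ℝ⁺∞
1/ ε = fin (ε ⁻¹) (⁻¹-nonNeg ε)

IsSup : (ℝ⁺∞ → Set) → ℝ⁺∞ → Set
IsSup S x = (∀ y → S y → y ≤∞ x) × (∀ u → (∀ y → S y → y ≤∞ u) → x ≤∞ u)

IsInf : (ℝ⁺∞ → Set) → ℝ⁺∞ → Set
IsInf S x = (∀ y → S y → x ≤∞ y) × (∀ l → (∀ y → S y → l ≤∞ y) → l ≤∞ x)

-- Close ε k p: k is ε-close to p.
Close : ℝ>0 → ℝ⁺∞ → ℝ⁺∞ → Set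
Close ε (fin k _) (fin p _) = ∣ k - p ∣ʳ ≤ proj₁ ε
Close ε ∞         (fin p _) = ⊥
Close ε k         ∞         = 1/ ε ≤∞ k

-- Above ε k p: k is ε-above p.
Above : ℝ>0 → ℝ⁺∞ → ℝ⁺∞ → Set
Above ε k p = ∃[ p′ ] Close ε p′ p × p′ ≤∞ k

------------------------------------------------------------------------
-- Quantitative parity games

data Player : Set where
  player0 player1 : Player

-- V is split into V₀ and V₁ by owner.  Weights and payoffs take their
-- proof arguments irrelevantly, so that they depend on positions only:
-- E and terminality act as a plain relation and a plain subset.
record QuantitativeParityGame : Set₁ where
  field
    V     : Set
    owner : V → Player
    E     : V → V → Set

  Terminal : V → Set
  Terminal v = ∀ w → ¬ E v w

  field
    δ           : (v w : V) → .(E v w) → ℝ>0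
    payoff      : (v : V) → .(Terminal v) → ℝ⁺∞
    maxPriority : ℕ
    Ω           : V → Fin (suc maxPriority)

module _ (G : QuantitativeParityGame) where
  open QuantitativeParityGame G

  -- History u v: a finite path from u to v.
  data History (u : V) : V → Set where
    start  : History u u
    extend : ∀ {v} → History u v → (w : V) → .(E v w) → History u w

  weight : ∀ {u v} → History u v → ℝ>0
  weight start                = 1ℝ>0
  weight (extend {v} h w vEw) = weight h *⁺ δ v w vEw

  Strategy : Player → Set
  Strategy i = ∀ {u v} → History u v → .(owner v ≡ i) → .(¬ Terminal v) →
               Σ[ w ∈ V ] E v w

  Positional : ∀ {i} → Strategy i → Set
  Positional {i} σ =
    ∀ {u u′ v} (h : History u v) (h′ : History u′ v)
      (own : owner v ≡ i) (nt : ¬ Terminal v) →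
    proj₁ (σ h own nt) ≡ proj₁ (σ h′ own nt)

  data Play (v : V) : Set where
    finite   : ∀ {w} → History v w → Terminal w → Play v
    infinite : (π : ℕ → V) → π 0 ≡ v → (∀ n → E (π n) (π (suc n))) → Play v

  prefix : (π : ℕ → V) → (∀ n → E (π n) (π (suc n))) → ∀ n → History (π 0) (π n)
  prefix π edge zero    = start
  prefix π edge (suc n) = extend (prefix π edge n) (π (suc n)) (edge n)

  ConsistentHistory : ∀ {i u v} → Strategy i → History u v → Set
  ConsistentHistory σ start = ⊤
  ConsistentHistory {i} σ (extend {v} h w vEw) =
    ConsistentHistory {i} σ h ×
    ((own : owner v ≡ i) → proj₁ (σ h own (λ t → t w vEw)) ≡ w)

  Consistent : ∀ {i v} → Strategy i → Play v → Set
  Consistent {i} σ (finite h _)        = ConsistentHistory {i} σ h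
  Consistent {i} σ (infinite π _ edge) =
    ∀ n → ConsistentHistory {i} σ (prefix π edge n)

  InfinitelyOften : (ℕ → V) → ℕ → Set
  InfinitelyOften π k = ∀ N → ∃[ n ] N ℕ.≤ n × toℕ (Ω (π n)) ≡ k

  LowestInfinitelyOften : (ℕ → V) → ℕ → Set
  LowestInfinitelyOften π k =
    InfinitelyOften π k × (∀ j → InfinitelyOften π j → k ℕ.≤ j)

  -- A relation rather than a function: without excluded middle the lowest
  -- priority occurring infinitely often cannot be computed.
  IsOutcome : ∀ {v} → Play v → ℝ⁺∞ → Set
  IsOutcome (finite {w} h t) p = p ≈∞ weight h · payoff w t
  IsOutcome (infinite π _ _) p =
    ∃[ k ] LowestInfinitelyOften π k ×
      ((2 ∣ k × p ≈∞ ∞) ⊎ (¬ 2 ∣ k × p ≈∞ 0∞))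

  -- p is the outcome of the play π_{σ,ρ}(v).  That play is described as the
  -- one consistent with σ and ρ, since computing it would require deciding
  -- terminality and whether it is finite.
  OutcomeOf : Strategy player0 → Strategy player1 → V → ℝ⁺∞ → Set
  OutcomeOf σ ρ v p =
    Σ[ π ∈ Play v ] Consistent {player0} σ π × Consistent {player1} ρ π × IsOutcome π p

  IsSupInf : V → ℝ⁺∞ → Set
  IsSupInf v = IsSup λ x → Σ[ σ ∈ Strategy player0 ]
    IsInf (λ p → Σ[ ρ ∈ Strategy player1 ] OutcomeOf σ ρ v p) x

  IsInfSup : V → ℝ⁺∞ → Set
  IsInfSup v = IsInf λ x → Σ[ ρ ∈ Strategy player1 ]
    IsSup (λ p → Σ[ σ ∈ Strategy player0 ] OutcomeOf σ ρ v p) x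

  record Determined : Set where
    field
      val         : V → ℝ⁺∞
      val-sup-inf : ∀ v → IsSupInf v (val v)
      val-inf-sup : ∀ v → IsInfSup v (val v)

  -- The value used by ε-optimality is that of the determined game.
  Optimal : Determined → ℝ>0 → Strategy player0 → V → Set
  Optimal det ε σ v = ∀ (ρ : Strategy player1) p →
    OutcomeOf σ ρ v p → Above ε p (Determined.val det v)

{-# OPTIONS --safe #-}

-- Player 0 owns a position with an odd priority at which she may either
-- double the current gain and stay, or leave to a terminal position with
-- payoff 1.  Staying n times and then leaving yields 2ⁿ, so the value is ∞.
-- A positional strategy either leaves at once, with outcome 1, or stays
-- forever, with outcome 0; neither reaches 1/ε when ε < 1.

module Submission where

open import Defs
open import Data.Empty using (⊥; ⊥-elim; ⊥-elim-irr)
open import Data.Fin using (zero; suc)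
open import Data.Integer as ℤ using (+_; -[1+_])
import Data.Integer.Properties as ℤ
open import Data.Nat as ℕ using (ℕ; zero; suc; z≤n; s≤s)
import Data.Nat.Coprimality as Coprimality
open import Data.Nat.Divisibility using (_∣?_)
import Data.Nat.Properties as ℕ
open import Data.Product using (Σ-syntax; _×_; _,_; proj₁; proj₂)
open import Data.Rational as ℚ using (ℚ; mkℚ; 0ℚ; 1ℚ; ½)
import Data.Rational.Properties as ℚ
open import Data.Rational.Solver using (module +-*-Solver)
open import Data.Sum using (inj₁; inj₂)
open import Data.Unit using (⊤; tt)
open import Relation.Binary.PropositionalEquality
open import Relation.Nullary using (¬_)
open import Relation.Nullary.Decidable using (from-yes; from-no)

-- Archimedean property of the Cauchy reals

0<1 : 0ℚ ℚ.< 1ℚ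
0<1 = ℚ.positive⁻¹ 1ℚ

fromℕ : ℕ → ℚ
fromℕ n = mkℚ (+ n) 0 (Coprimality.sym (Coprimality.1-coprimeTo n))

fromℕ-suc : ∀ n → fromℕ n ℚ.+ 1ℚ ≡ fromℕ (suc n)
fromℕ-suc n = trans
  (cong (ℚ._/ 1) (trans
    (cong (ℤ._+ + 1) (ℤ.*-identityʳ (+ n)))
    (cong +_ (ℕ.+-comm n 1))))
  (ℚ.↥p/↧p≡p (fromℕ (suc n)))

-- The denominator is at least 1, so dropping it can only increase a non-negative fraction; a
-- negative fraction lies below every natural number.
≤-fromℕ : ∀ q → q ℚ.≤ fromℕ ℤ.∣ ℚ.↥ q ∣
≤-fromℕ (mkℚ (+ n) d _) = ℚ.*≤* (subst₂ ℤ._≤_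
  (ℤ.pos-* n 1) (ℤ.pos-* n (suc d)) (ℤ.+≤+ (ℕ.*-monoʳ-≤ n (s≤s z≤n))))
≤-fromℕ (mkℚ -[1+ n ] d _) = ℚ.*≤* ℤ.-≤+

p-q<r⇒p<q+r : ∀ {p q r} → p ℚ.- q ℚ.< r → p ℚ.< q ℚ.+ r
p-q<r⇒p<q+r {p} {q} {r} lt = subst (ℚ._< q ℚ.+ r)
  (solve 2 (λ p q → q :+ (p :- q) := p) refl p q)
  (ℚ.+-monoʳ-< q lt)
  where open +-*-Solver

p≤∣p∣ : ∀ p → p ℚ.≤ ℚ.∣ p ∣
p≤∣p∣ p with ℚ.≤-total 0ℚ p
... | inj₁ 0≤p = ℚ.≤-reflexive (sym (ℚ.0≤p⇒∣p∣≡p 0≤p))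
... | inj₂ p≤0 = ℚ.≤-trans p≤0 (ℚ.0≤∣p∣ p)

unbounded : (x : ℝ) (y : ℕ → ℝ) → (∀ n m → fromℕ n ℚ.≤ seq (y n) m) →
            ¬ (∀ n → y n ≤ x)
unbounded x y n≤yₙ y≤x with cauchy x 1ℚ 0<1
... | N , close = go (y≤x k 1ℚ 0<1)
  where
  b = seq x N
  -- One unit covers the oscillation of the tail of `x` around `b`, the other the tolerance at which
  -- `y k ≤ x` is applied.
  k = suc (suc ℤ.∣ ℚ.↥ b ∣)
  b+2≤k : (b ℚ.+ 1ℚ) ℚ.+ 1ℚ ℚ.≤ fromℕ k
  b+2≤k = subst ((b ℚ.+ 1ℚ) ℚ.+ 1ℚ ℚ.≤_)
    (trans (cong (ℚ._+ 1ℚ) (fromℕ-suc ℤ.∣ ℚ.↥ b ∣)) (fromℕ-suc (suc ℤ.∣ ℚ.↥ b ∣)))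
    (ℚ.+-monoˡ-≤ 1ℚ (ℚ.+-monoˡ-≤ 1ℚ (≤-fromℕ b)))
  go : ¬ Eventually λ n → seq (y k) n ℚ.< seq x n ℚ.+ 1ℚ
  go (M , yₖ<x+1) = ℚ.<-irrefl refl (begin-strict
    seq (y k) m          <⟨ yₖ<x+1 m (ℕ.m≤n⊔m N M) ⟩
    seq x m ℚ.+ 1ℚ       <⟨ ℚ.+-monoˡ-< 1ℚ (p-q<r⇒p<q+r {seq x m} {b} (ℚ.≤-<-trans
                              (p≤∣p∣ (seq x m ℚ.- b))
                              (close m N (ℕ.m≤m⊔n N M) ℕ.≤-refl))) ⟩
    (b ℚ.+ 1ℚ) ℚ.+ 1ℚ    ≤⟨ b+2≤k ⟩
    fromℕ k              ≤⟨ n≤yₙ k m ⟩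
    seq (y k) m          ∎)
    where
    open ℚ.≤-Reasoning
    m = N ℕ.⊔ M

-- Order on the extended reals and closeness to ∞

≤-refl : (x : ℝ) → x ≤ x
≤-refl x ε 0<ε = 0 , λ n _ → subst (ℚ._< seq x n ℚ.+ ε)
  (ℚ.+-identityʳ (seq x n)) (ℚ.+-monoʳ-< (seq x n) 0<ε)

≤-trans : (x y z : ℝ) → x ≤ y → y ≤ z → x ≤ z
≤-trans x y z x≤y y≤z ε 0<ε with x≤y (½ ℚ.* ε) 0<ε/2 | y≤z (½ ℚ.* ε) 0<ε/2
  where
  0<ε/2 : 0ℚ ℚ.< ½ ℚ.* ε
  0<ε/2 = subst (ℚ._< ½ ℚ.* ε) (ℚ.*-zeroʳ ½) (ℚ.*-monoʳ-<-pos ½ 0<ε)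
... | N , p | M , q = N ℕ.⊔ M , λ n l → begin-strict
  seq x n                                <⟨ p n (ℕ.m⊔n≤o⇒m≤o N M l) ⟩
  seq y n ℚ.+ ½ ℚ.* ε                    <⟨ ℚ.+-monoˡ-< (½ ℚ.* ε)
                                              (q n (ℕ.m⊔n≤o⇒n≤o N M l)) ⟩
  (seq z n ℚ.+ ½ ℚ.* ε) ℚ.+ ½ ℚ.* ε      ≡⟨ solve 2 (λ z ε →
                                              (z :+ con ½ :* ε) :+ con ½ :* ε := z :+ ε)
                                              refl (seq z n) ε ⟩
  seq z n ℚ.+ ε                          ∎
  where
  open ℚ.≤-Reasoning
  open +-*-Solver

≤∞-refl : ∀ p → p ≤∞ p
≤∞-refl (fin x _) = ≤-refl x
≤∞-refl ∞         = tt

≤∞-trans : ∀ p q r → p ≤∞ q → q ≤∞ r → p ≤∞ r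
≤∞-trans (fin x _) (fin y _) (fin z _) p≤q q≤r = ≤-trans x y z p≤q q≤r
≤∞-trans (fin _ _) _         ∞         _   _   = tt
≤∞-trans ∞         _         ∞         _   _   = tt
≤∞-trans ∞         ∞         (fin _ _) _   ()

≤∞-max : ∀ p → p ≤∞ ∞
≤∞-max (fin _ _) = tt
≤∞-max ∞         = tt

-- If ε + r < 1 and 1/ε < 1 + r, then 1 = ε · 1/ε < ε + ε r < ε + r < 1.
ε<1⇒ε⁻¹≰1 : (ε : ℝ>0) (y : ℝ) → proj₁ ε < 1ℝ → (∀ n → seq y n ℚ.≤ 1ℚ) → ¬ ε ⁻¹ ≤ y
ε<1⇒ε⁻¹≰1 (e , q , 0<q , N , q<e) y (r , 0<r , M , e+r<1) y≤1 ε⁻¹≤y =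
  go (ε⁻¹≤y r 0<r)
  where
  go : ¬ Eventually λ n → seq ((e , q , 0<q , N , q<e) ⁻¹) n ℚ.< seq y n ℚ.+ r
  go (K , i<y+r) = ℚ.<-irrefl refl (begin-strict
    1ℚ                  ≡⟨ sym (ℚ.*-inverseʳ a {{ℚ.>-nonZero 0<a}}) ⟩
    a ℚ.* i             <⟨ ℚ.*-monoʳ-<-pos a {{ℚ.positive 0<a}} (i<y+r n (ℕ.m≤n⊔m M K)) ⟩
    a ℚ.* (seq y n ℚ.+ r)
                        ≤⟨ ℚ.*-monoˡ-≤-nonNeg a {{ℚ.nonNegative (ℚ.<⇒≤ 0<a)}}
                             (ℚ.+-monoˡ-≤ r (y≤1 n)) ⟩
    a ℚ.* (1ℚ ℚ.+ r)    ≡⟨ solve 2 (λ a r → a :* (con 1ℚ :+ r) := a :+ a :* r) refl a r ⟩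
    a ℚ.+ a ℚ.* r       <⟨ ℚ.+-monoʳ-< a (ℚ.*-monoˡ-<-pos r {{ℚ.positive 0<r}} a<1) ⟩
    a ℚ.+ 1ℚ ℚ.* r      ≡⟨ cong (a ℚ.+_) (ℚ.*-identityˡ r) ⟩
    a ℚ.+ r             <⟨ a+r<1 ⟩
    1ℚ                  ∎)
    where
    open ℚ.≤-Reasoning
    open +-*-Solver
    n = M ℕ.⊔ K
    -- The reciprocal at index `n` inverts the entry of `e` at index `N + n`, so `a` and `i`
    -- multiply to exactly 1.
    a = seq e (N ℕ.+ n)
    i = seq ((e , q , 0<q , N , q<e) ⁻¹) n
    0<a : 0ℚ ℚ.< a
    0<a = ℚ.<-trans 0<q (subst (ℚ._< a) (ℚ.+-identityˡ q) (q<e (N ℕ.+ n) (ℕ.m≤m+n N n)))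
    a+r<1 : a ℚ.+ r ℚ.< 1ℚ
    a+r<1 = e+r<1 (N ℕ.+ n) (ℕ.≤-trans (ℕ.m≤m⊔n M K) (ℕ.m≤n+m n N))
    a<1 : a ℚ.< 1ℚ
    a<1 = ℚ.<-trans (subst (ℚ._< a ℚ.+ r) (ℚ.+-identityʳ a) (ℚ.+-monoʳ-< a 0<r)) a+r<1

≤1⇒¬Above-∞ : (ε : ℝ>0) → proj₁ ε < 1ℝ → ∀ p y 0≤y → (∀ n → seq y n ℚ.≤ 1ℚ) →
              p ≤∞ fin y 0≤y → ¬ Above ε p ∞
≤1⇒¬Above-∞ ε ε<1 p y 0≤y y≤1 p≤y (p′ , close , p′≤p) =
  ε<1⇒ε⁻¹≰1 ε y ε<1 y≤1
    (≤∞-trans (1/ ε) p′ (fin y 0≤y) (1/ε≤ p′ close) (≤∞-trans p′ p (fin y 0≤y) p′≤p p≤y))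
  where
  1/ε≤ : ∀ k → Close ε k ∞ → 1/ ε ≤∞ k
  1/ε≤ (fin _ _) c = c
  1/ε≤ ∞         _ = tt

-- The game

data Position : Set where
  loop exit : Position

Move : Position → Position → Set
Move loop _ = ⊤
Move exit _ = ⊥

2ℚ : ℚ
2ℚ = 1ℚ ℚ.+ 1ℚ

-- Indexed by the target of a move: staying doubles the gain, leaving keeps it.
gain : Position → ℝ>0
gain loop = fromℚ 2ℚ , 1ℚ , 0<1 , 0 , λ _ _ → from-yes (0ℚ ℚ.+ 1ℚ ℚ.<? 2ℚ)
gain exit = 1ℝ>0

1∞ : ℝ⁺∞
1∞ = fin 1ℝ λ ε 0<ε → 0 , λ _ _ → ℚ.+-mono-< 0<1 0<ε

G : QuantitativeParityGame
G = record
  { V           = Position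
  ; owner       = λ _ → player0
  ; E           = Move
  ; δ           = λ _ w _ → gain w
  ; payoff      = λ _ _ → 1∞
  ; maxPriority = 1
  ; Ω           = λ _ → suc zero
  }

open QuantitativeParityGame G using (Terminal; payoff)

exit-terminal : Terminal exit
exit-terminal _ ()

loop-nonterminal : ¬ Terminal loop
loop-nonterminal terminal = terminal loop tt

move-loop : ∀ v w → Move v w → v ≡ loop
move-loop loop _ _ = refl

-- Opaque, as conversion checking would otherwise unfold the Cauchy proofs
-- of the weights.
opaque
  gainOf : ∀ {v w} → History G v w → .(Terminal w) → ℝ⁺∞
  gainOf {w = w} h t = weight G h · payoff w t

  gainOf-attained : ∀ {v w} (h : History G v w) t → IsOutcome G (finite h t) (gainOf h t)
  gainOf-attained h t = ≤∞-refl (gainOf h t) , ≤∞-refl (gainOf h t)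

  gainOf-unique : ∀ {v w} (h : History G v w) t p → IsOutcome G (finite h t) p → p ≈∞ gainOf h t
  gainOf-unique _ _ _ p≈ = p≈

nonterminal-move : ∀ v w → .(¬ Terminal v) → Move v w
nonterminal-move loop _ _  = tt
nonterminal-move exit _ nt = ⊥-elim-irr (nt exit-terminal)

-- Strategies that leave after a fixed number of moves

length : ∀ {u v} → History G u v → ℕ
length start          = 0
length (extend h _ _) = suc (length h)

-- Player 1 owns no position, so the empty case split is a strategy; it serves wherever some `ρ`
-- must be exhibited.
idle : Strategy G player1
idle _ () _

player1-consistent : (ρ : Strategy G player1) → ∀ {u v} (h : History G u v) →
                     ConsistentHistory G {player1} ρ h
player1-consistent ρ start          = tt
player1-consistent ρ (extend h _ _) = player1-consistent ρ h , λ ()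

loopUntil : ℕ → ℕ → Position
loopUntil zero    _       = exit
loopUntil (suc n) zero    = loop
loopUntil (suc n) (suc l) = loopUntil n l

loopUntil-refl : ∀ n → loopUntil n n ≡ exit
loopUntil-refl zero    = refl
loopUntil-refl (suc n) = loopUntil-refl n

loopUntil-< : ∀ {n l} → l ℕ.< n → loopUntil n l ≡ loop
loopUntil-< {suc n} {zero}  _         = refl
loopUntil-< {suc n} {suc l} (s≤s l<n) = loopUntil-< l<n

loopUntil≡exit : ∀ n l → loopUntil n l ≡ exit → n ℕ.≤ l
loopUntil≡exit zero    _       _  = z≤n
loopUntil≡exit (suc n) (suc l) eq = s≤s (loopUntil≡exit n l eq)

loopUntil≡loop : ∀ n l → loopUntil n l ≡ loop → l ℕ.< n
loopUntil≡loop (suc n) zero    _  = s≤s z≤n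
loopUntil≡loop (suc n) (suc l) eq = s≤s (loopUntil≡loop n l eq)

-- The choice depends on the length of the history, which makes the strategy non-positional for
-- every positive `n`.
exitAfter : ℕ → Strategy G player0
exitAfter n {v = v} h _ nt = w , nonterminal-move v w nt
  where w = loopUntil n (length h)

loops : ℕ → History G loop loop
loops zero    = start
loops (suc n) = extend (loops n) loop tt

length-loops : ∀ n → length (loops n) ≡ n
length-loops zero    = refl
length-loops (suc n) = cong suc (length-loops n)

-- No move leads out of `exit`, so every intermediate position is `loop` and only the length is
-- free.
loops-length : (h : History G loop loop) → h ≡ loops (length h)
loops-length start                   = refl
loops-length (extend {loop} h .loop _) = cong (λ h → extend h loop tt) (loops-length h)
loops-length (extend {exit} h .loop e) = ⊥-elim-irr e

loops-consistent : ∀ n k → k ℕ.≤ n → ConsistentHistory G {player0} (exitAfter n) (loops k)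
loops-consistent n zero    _   = tt
loops-consistent n (suc k) k<n =
  loops-consistent n k (ℕ.<⇒≤ k<n) ,
  λ _ → loopUntil-< (subst (ℕ._< n) (sym (length-loops k)) k<n)

-- The last move back to `loop` was chosen by `exitAfter n`, which stays only while fewer than `n`
-- moves have been made.
consistent-length : ∀ n (h : History G loop loop) →
                    ConsistentHistory G {player0} (exitAfter n) h → length h ℕ.≤ n
consistent-length n start                     _       = z≤n
consistent-length n (extend {loop} h .loop _) (_ , c) = loopUntil≡loop n (length h) (c refl)
consistent-length n (extend {exit} h .loop e) _       = ⊥-elim-irr e

path : ∀ n → History G loop exit
path n = extend (loops n) exit tt

outcome : ℕ → ℝ⁺∞
outcome n = gainOf (path n) exit-terminal

outcome-attained : ∀ n (ρ : Strategy G player1) → OutcomeOf G (exitAfter n) ρ loop (outcome n)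
outcome-attained n ρ =
  finite (path n) exit-terminal ,
  (loops-consistent n n ℕ.≤-refl ,
    λ _ → trans (cong (loopUntil n) (length-loops n)) (loopUntil-refl n)) ,
  player1-consistent ρ (path n) ,
  gainOf-attained (path n) exit-terminal

length-prefix : ∀ π (move : ∀ n → Move (π n) (π (suc n))) n →
                length (prefix G π move n) ≡ n
length-prefix π move zero    = refl
length-prefix π move (suc n) = cong suc (length-prefix π move n)

-- The only consistent play is `path n`: consistency bounds the number of loops by `n` from above,
-- and the choice of `exit` bounds it from below.
outcome-least : ∀ n (ρ : Strategy G player1) p →
                OutcomeOf G (exitAfter n) ρ loop p → outcome n ≤∞ p
outcome-least n ρ p (finite {loop} _ t , _) = ⊥-elim (loop-nonterminal t)
outcome-least n ρ p (finite {exit} (extend {exit} _ _ e) _ , _) = ⊥-elim-irr e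
outcome-least n ρ p (finite {exit} (extend {loop} h _ e) t , (con , c) , _ , o) =
  subst (λ h → gainOf (extend h exit tt) exit-terminal ≤∞ p)
    (trans (loops-length h) (cong loops (ℕ.≤-antisym
      (consistent-length n h con)
      (loopUntil≡exit n (length h) (c refl)))))
    (proj₂ (gainOf-unique (extend h exit e) t p o))
outcome-least n ρ p (infinite π _ move , con , _)
  -- After `n` moves the strategy chooses `exit`, but in an infinite play the position reached has a
  -- further move, hence is `loop`.
  with trans (sym (loopUntil-refl n))
         (trans (cong (loopUntil n) (sym (length-prefix π move n)))
           (trans (proj₂ (con (suc n)) refl)
             (move-loop (π (suc n)) (π (suc (suc n))) (move (suc n)))))
... | ()

outcome-inf : ∀ n → IsInf (λ p → Σ[ ρ ∈ Strategy G player1 ] OutcomeOf G (exitAfter n) ρ loop p)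
                      (outcome n)
outcome-inf n =
  (λ p (ρ , o) → outcome-least n ρ p o) ,
  (λ l lower → lower (outcome n) (idle , outcome-attained n idle))

-- Unboundedness of the outcomes

-- A linear bound on the powers of 2 suffices. The bound by 1 is carried along because doubling `w`
-- must add at least 1 to it.
weight-loops : ∀ n m → fromℕ n ℚ.≤ seq (proj₁ (weight G (loops n))) m ×
                       1ℚ ℚ.≤ seq (proj₁ (weight G (loops n))) m
weight-loops zero    m = ℚ.<⇒≤ 0<1 , ℚ.≤-refl
weight-loops (suc n) m with weight-loops n m
... | n≤w , 1≤w =
  subst₂ ℚ._≤_ (fromℕ-suc n) w+w≡w*2 (ℚ.+-mono-≤ n≤w 1≤w) ,
  subst (1ℚ ℚ.≤_) w+w≡w*2 (ℚ.≤-trans (ℚ.<⇒≤ (from-yes (1ℚ ℚ.<? 2ℚ))) (ℚ.+-mono-≤ 1≤w 1≤w))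
  where
  w = seq (proj₁ (weight G (loops n))) m
  w+w≡w*2 : w ℚ.+ w ≡ w ℚ.* 2ℚ
  w+w≡w*2 = solve 1 (λ w → w :+ w := w :* (con 1ℚ :+ con 1ℚ)) refl w
    where open +-*-Solver

opaque
  unfolding gainOf

  outcome-unbounded : ∀ u → (∀ n → outcome n ≤∞ u) → ∞ ≤∞ u
  outcome-unbounded ∞         _         = tt
  outcome-unbounded (fin x _) outcome≤x =
    unbounded x (λ n → proj₁ (weight G (path n)) * 1ℝ)
      (λ n m → subst (fromℕ n ℚ.≤_)
        -- One factor 1 is the weight of the move to `exit`, the other the payoff there.
        (sym (trans (ℚ.*-identityʳ _) (ℚ.*-identityʳ _)))
        (proj₁ (weight-loops n m)))
      outcome≤x

  outcome-0 : outcome 0 ≤∞ 1∞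
  outcome-0 ε 0<ε = 0 , λ _ _ → ℚ.+-monoʳ-< 1ℚ 0<ε

-- Values and determinacy

-- Stating it for the endpoint lets any further move be transported to a move out of `exit`, which
-- is absurd.
exit-history : ∀ {w} → History G exit w → w ≡ exit
exit-history start          = refl
exit-history (extend h w e) = ⊥-elim-irr (subst (λ v → Move v w) (exit-history h) e)

exitOutcome : ℝ⁺∞
exitOutcome = gainOf {exit} start exit-terminal

exitOutcome-attained : (σ : Strategy G player0) (ρ : Strategy G player1) →
                       OutcomeOf G σ ρ exit exitOutcome
exitOutcome-attained σ ρ =
  finite start exit-terminal , tt , tt , gainOf-attained start exit-terminal

exitOutcome-unique : (σ : Strategy G player0) (ρ : Strategy G player1) →
                     ∀ p → OutcomeOf G σ ρ exit p → p ≈∞ exitOutcome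
exitOutcome-unique σ ρ p (finite start t , _ , _ , o) = gainOf-unique start t p o
exitOutcome-unique σ ρ p (finite (extend h w e) _ , _) =
  ⊥-elim-irr (subst (λ v → Move v w) (exit-history h) e)
exitOutcome-unique σ ρ p (infinite π π₀ move , _)
  with trans (sym π₀) (move-loop (π 0) (π 1) (move 0))
... | ()

value : Position → ℝ⁺∞
value loop = ∞
value exit = exitOutcome

value-sup-inf : ∀ v → IsSupInf G v (value v)
value-sup-inf loop =
  (λ y _ → ≤∞-max y) ,
  -- Each `outcome n` is the infimum guaranteed by `exitAfter n`, so an upper bound `u` dominates
  -- all of them.
  (λ u upper → outcome-unbounded u λ n → upper (outcome n) (exitAfter n , outcome-inf n))
value-sup-inf exit =
  (λ y (σ , inf) → proj₁ inf exitOutcome (idle , exitOutcome-attained σ idle)) ,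
  (λ u upper → upper exitOutcome
    -- Any strategy would serve: from `exit` no move is made and all outcomes agree.
    ( exitAfter 0
    , (λ p (ρ , o) → proj₂ (exitOutcome-unique (exitAfter 0) ρ p o))
    , (λ l lower → lower exitOutcome (idle , exitOutcome-attained (exitAfter 0) idle))))

value-inf-sup : ∀ v → IsInfSup G v (value v)
value-inf-sup loop =
  -- Against every `ρ` Player 0 can still attain each `outcome n`, so every supremum is already ∞.
  (λ y (ρ , sup) → outcome-unbounded y λ n →
    proj₁ sup (outcome n) (exitAfter n , outcome-attained n ρ)) ,
  (λ l _ → ≤∞-max l)
value-inf-sup exit =
  (λ y (ρ , sup) → proj₁ sup exitOutcome (exitAfter 0 , exitOutcome-attained (exitAfter 0) ρ)) ,
  (λ l lower → lower exitOutcome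
    ( idle
    , (λ p (σ , o) → proj₁ (exitOutcome-unique σ idle p o))
    , (λ u upper → upper exitOutcome (exitAfter 0 , exitOutcome-attained (exitAfter 0) idle))))

determined : Determined G
determined = record
  { val         = value
  ; val-sup-inf = value-sup-inf
  ; val-inf-sup = value-inf-sup
  }

-- Failure of positional strategies

stay-forever : (σ : Strategy G player0) → Positional G {player0} σ →
               proj₁ (σ {loop} start refl loop-nonterminal) ≡ loop →
               OutcomeOf G σ idle loop 0∞
stay-forever σ positional stays =
  infinite (λ _ → loop) refl (λ _ → tt) ,
  consistent ,
  (λ n → player1-consistent idle (prefix G (λ _ → loop) (λ _ → tt) n)) ,
  1 ,
  -- The priority is constantly 1, so it recurs and any recurring priority equals it.
  ((λ N → N , ℕ.≤-refl , refl) , λ j j-often → ℕ.≤-reflexive (proj₂ (proj₂ (j-often 0)))) ,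
  inj₂ (from-no (2 ∣? 1) , ≤∞-refl 0∞ , ≤∞-refl 0∞)
  where
  consistent : ∀ n → ConsistentHistory G {player0} σ (prefix G (λ _ → loop) (λ _ → tt) n)
  consistent zero    = tt
  consistent (suc n) = consistent n , λ _ →
    -- Positionality transfers the choice at the empty history to each longer history ending in
    -- `loop`.
    trans (positional (prefix G (λ _ → loop) (λ _ → tt) n) (start {u = loop})
            refl loop-nonterminal)
          stays

leave-at-once : (σ : Strategy G player0) →
                proj₁ (σ {loop} start refl loop-nonterminal) ≡ exit →
                OutcomeOf G σ idle loop (outcome 0)
leave-at-once σ leaves =
  finite (path 0) exit-terminal ,
  (tt , λ _ → leaves) ,
  player1-consistent idle (path 0) ,
  gainOf-attained (path 0) exit-terminal

mainTheorem3 : Σ[ G ∈ QuantitativeParityGame ]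
    Σ[ det ∈ Determined G ]
    Σ[ v ∈ QuantitativeParityGame.V G ]
    ((ε : ℝ) (0<ε : 0ℝ < ε) → ε < 1ℝ →
    (σ : Strategy G player0) → Positional G {player0} σ →
    ¬ Optimal G det (ε , 0<ε) σ v)
mainTheorem3 = G , determined , loop , notOptimal
  where
  notOptimal : (ε : ℝ) (0<ε : 0ℝ < ε) → ε < 1ℝ →
               (σ : Strategy G player0) → Positional G {player0} σ →
               ¬ Optimal G determined (ε , 0<ε) σ loop
  notOptimal ε 0<ε ε<1 σ positional optimal
    with proj₁ (σ {loop} start refl loop-nonterminal) in choice
  ... | loop = ≤1⇒¬Above-∞ (ε , 0<ε) ε<1 0∞ 0ℝ (≤-refl 0ℝ) (λ _ → ℚ.<⇒≤ 0<1) (≤∞-refl 0∞)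
                 (optimal idle 0∞ (stay-forever σ positional choice))
  ... | exit = ≤1⇒¬Above-∞ (ε , 0<ε) ε<1 (outcome 0) 1ℝ _ (λ _ → ℚ.≤-refl) outcome-0
                 (optimal idle (outcome 0) (leave-at-once σ choice))
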